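{- Inner p-transitivity fails in general: there exist a language $L$, an $L$-algebra $\mathfrak A$ with universe $A$, and elements $a,b,c,d,e,f\in A$ such that $a:b\approx_{\mathfrak A}c:d$ and $b:e\approx_{\mathfrak A}d:f$ hold, but $a:e\approx_{\mathfrak A}c:f$ does not hold.
   Context: Let $L$ be a language of algebras: a set of function symbols, each with an arity in $\mathbb N$ (constants are 0-ary function symbols). Fix a countably infinite set $X$ of variables; $T_{L,X}$ is the set of $L$-terms over $X$, and $X(s)$ denotes the set of variables occurring in a term $s$. For an $L$-algebra $\mathfrak A$ with universe $A$, every term $s$ induces a function $s^{\mathfrak A}$, evaluated at assignments of elements of $A$ to variables. An arrow of $\mathfrak A$ is a pair $(a,b)\in A\times A$, written $a\to b$. The generalizations of an arrow $a\to b$ in $\mathfrak A$ are the pairs of arbitrary terms $s\to t$ with $s,t\in T_{L,X}$ such that there is an assignment $\sigma$ of elements of $A$ to the variables in $X(s)\cup X(t)$ with $s^{\mathfrak A}(\sigma)=a$ and $t^{\mathfrak A}(\sigma)=b$; their set is denoted $\uparrow_{\mathfrak A}(a\to b)$. For $L$-algebras $\mathfrak A,\mathfrak B$, an arrow $a\to b$ of $\mathfrak A$ and an arrow $c\to d$ of $\mathfrak B$, set $(a\to b)\uparrow_{(\mathfrak A,\mathfrak B)}(c\to d):=\uparrow_{\mathfrak A}(a\to b)\cap\uparrow_{\mathfrak B}(c\to d)$. A pair of terms $s\to t$ is trivial in $(\mathfrak A,\mathfrak B)$ if it belongs to $\uparrow_{\mathfrak A}(e)$ for every arrow $e$ of $\mathfrak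 A$ and to $\uparrow_{\mathfrak B}(e')$ for every arrow $e'$ of $\mathfrak B$. We write $a\to b\lesssim_{(\mathfrak A,\mathfrak B)}c\to d$ iff either (i) every element of $\uparrow_{\mathfrak A}(a\to b)\cup\uparrow_{\mathfrak B}(c\to d)$ is trivial in $(\mathfrak A,\mathfrak B)$, or (ii) $(a\to b)\uparrow_{(\mathfrak A,\mathfrak B)}(c\to d)$ contains an element not trivial in $(\mathfrak A,\mathfrak B)$ and, for every arrow $c'\to d'$ of $\mathfrak B$, the inclusion $(a\to b)\uparrow_{(\mathfrak A,\mathfrak B)}(c\to d)\subseteq(a\to b)\uparrow_{(\mathfrak A,\mathfrak B)}(c'\to d')$ implies equality of these two sets. Define $a\to b\approx_{(\mathfrak A,\mathfrak B)}c\to d$ iff $a\to b\lesssim_{(\mathfrak A,\mathfrak B)}c\to d$ and $c\to d\lesssim_{(\mathfrak B,\mathfrak A)}a\to b$. For $a,b\in A$ and $c,d\in B$, the similarity-based analogical proportion $a:b\approx_{(\mathfrak A,\mathfrak B)}c:d$ holds iff $a\to b\approx_{(\mathfrak A,\mathfrak B)}c\to d$ and $b\to a\approx_{(\mathfrak A,\mathfrak B)}d\to c$. We write $\approx_{\mathfrak A}$ for $\approx_{(\mathfrak A,\mathfrak A)}$. -}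

module Defs where

open import Data.Nat.Base using (ℕ)
open import Data.Product.Base using (_×_; _,_; ∃-syntax)
open import Data.Sum.Base using (_⊎_)
open import Data.Vec.Base using (Vec; []; _∷_)
open import Relation.Binary.PropositionalEquality.Core using (_≡_)
open import Relation.Nullary.Negation.Core using (¬_)
open import Relation.Unary using (Pred; _∈_; _∩_; _∪_; _⊆_; _≐_)
open import Level using (0ℓ)

record Language : Set₁ where
  field
    Symbol : Set
    arity  : Symbol → ℕ

open Language public

-- The countably infinite set of variables is ℕ.
data Term (L : Language) : Set where
  var : ℕ → Term L
  app : (f : Symbol L) → Vec (Term L) (arity L f) → Term L

record Algebra (L : Language) : Set₁ where
  field
    Universe : Set
    interp   : (f : Symbol L) → Vec Universe (arity L f) → Universe

open Algebra public

module _ {L : Language} where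

  Assignment : Algebra L → Set
  Assignment 𝔄 = ℕ → Universe 𝔄

  mutual
    eval : (𝔄 : Algebra L) → Term L → Assignment 𝔄 → Universe 𝔄
    eval 𝔄 (var x)    σ = σ x
    eval 𝔄 (app f ts) σ = interp 𝔄 f (evals 𝔄 ts σ)

    evals : ∀ {n} (𝔄 : Algebra L) → Vec (Term L) n → Assignment 𝔄 → Vec (Universe 𝔄) n
    evals 𝔄 []       σ = []
    evals 𝔄 (t ∷ ts) σ = eval 𝔄 t σ ∷ evals 𝔄 ts σ

  -- The pair (a , b) is the arrow a → b.
  Arrow : Algebra L → Set
  Arrow 𝔄 = Universe 𝔄 × Universe 𝔄

  -- The pair (s , t) is the pair of terms s → t.
  TermArrow : Set
  TermArrow = Term L × Term L

  -- Assignments are total.  An arrow exists only in a nonempty algebra, where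
  -- every assignment to the finitely many variables of s and t extends to all
  -- of ℕ, and values outside those variables do not affect eval.
  ↑ : (𝔄 : Algebra L) → Arrow 𝔄 → Pred TermArrow 0ℓ
  ↑ 𝔄 (a , b) (s , t) = ∃[ σ ] eval 𝔄 s σ ≡ a × eval 𝔄 t σ ≡ b

  common↑ : (𝔄 𝔅 : Algebra L) → Arrow 𝔄 → Arrow 𝔅 → Pred TermArrow 0ℓ
  common↑ 𝔄 𝔅 p q = ↑ 𝔄 p ∩ ↑ 𝔅 q

  Trivial : (𝔄 𝔅 : Algebra L) → Pred TermArrow 0ℓ
  Trivial 𝔄 𝔅 g = (∀ p → g ∈ ↑ 𝔄 p) × (∀ q → g ∈ ↑ 𝔅 q)

  ArrowLesssim : (𝔄 𝔅 : Algebra L) → Arrow 𝔄 → Arrow 𝔅 → Set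
  ArrowLesssim 𝔄 𝔅 p q =
      (↑ 𝔄 p ∪ ↑ 𝔅 q) ⊆ Trivial 𝔄 𝔅
    ⊎ (∃[ g ] g ∈ common↑ 𝔄 𝔅 p q × ¬ (g ∈ Trivial 𝔄 𝔅))
      × (∀ q′ → common↑ 𝔄 𝔅 p q ⊆ common↑ 𝔄 𝔅 p q′ →
                common↑ 𝔄 𝔅 p q ≐ common↑ 𝔄 𝔅 p q′)

  ArrowSimilar : (𝔄 𝔅 : Algebra L) → Arrow 𝔄 → Arrow 𝔅 → Set
  ArrowSimilar 𝔄 𝔅 p q = ArrowLesssim 𝔄 𝔅 p q × ArrowLesssim 𝔅 𝔄 q p

  -- Proportion 𝔄 𝔅 a b c d is a : b ≈ c : d in the pair (𝔄 , 𝔅).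
  Proportion : (𝔄 𝔅 : Algebra L) → (a b : Universe 𝔄) → (c d : Universe 𝔅) → Set
  Proportion 𝔄 𝔅 a b c d =
    ArrowSimilar 𝔄 𝔅 (a , b) (c , d) × ArrowSimilar 𝔄 𝔅 (b , a) (d , c)

{-# OPTIONS --safe #-}

-- Over the language without symbols all terms are variables.  If a ≢ b, the
-- arrow a → b is generalized only by pairs of distinct variables, which are
-- trivial; hence a : b ≈ c : d whenever a ≢ b and c ≢ d.  The pair x → x
-- generalizes exactly the arrows a → a, so a : a ≈ c : d forces c ≡ d.
-- Inner p-transitivity thus fails because ≢ is not transitive.
module Submission where

open import Data.Bool.Base using (if_then_else_)
open import Data.Empty using (⊥)
open import Data.Fin.Base using (Fin)
open import Data.Fin.Patterns using (0F; 1F; 2F)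
open import Data.Nat.Properties using (_≟_)
open import Data.Product.Base using (_×_; _,_; proj₁; proj₂; Σ-syntax; ∃-syntax)
open import Data.Sum.Base using (inj₁; inj₂; [_,_])
open import Function.Base using (_∘_)
open import Relation.Binary.PropositionalEquality using (_≡_; _≢_; refl; sym; trans; cong)
open import Relation.Nullary.Decidable using (does; dec-true; dec-false)
open import Relation.Nullary.Negation.Core using (¬_)
open import Relation.Unary using (_∈_; _⊆_)
open import Defs

-- The maximality clause, tested against p itself: common↑ 𝔄 𝔄 p p is ↑ 𝔄 p.
≲⇒↑⊆ : ∀ {L} {𝔄 : Algebra L} {p q} → ArrowLesssim 𝔄 𝔄 p q → ↑ 𝔄 p ⊆ ↑ 𝔄 q
≲⇒↑⊆ {q = q} (inj₁ trivial) {g} g∈↑p = proj₁ (trivial {g} (inj₁ g∈↑p)) q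
≲⇒↑⊆ {p = p} (inj₂ (_ , maximal)) {g} g∈↑p =
  proj₂ (proj₂ (maximal p λ (h∈↑p , _) → h∈↑p , h∈↑p) {g} (g∈↑p , g∈↑p))

∅ : Language
∅ = record { Symbol = ⊥ ; arity = λ () }

discrete : Set → Algebra ∅
discrete A = record { Universe = A ; interp = λ () }

module _ {A : Set} where

  distinct-vars-generalize : ∀ {x y} → x ≢ y → ∀ p → (var x , var y) ∈ ↑ (discrete A) p
  distinct-vars-generalize {x} {y} x≢y (a , b) =
      -- Sends `x` to `a` and every other variable, hence `y`, to `b`.
      (λ z → if does (z ≟ x) then a else b)
    , cong (if_then a else b) (dec-true (x ≟ x) refl)
    , cong (if_then a else b) (dec-false (y ≟ x) (x≢y ∘ sym))

  ↑-distinct⊆Trivial : ∀ {a b : A} → a ≢ b →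
                       ↑ (discrete A) (a , b) ⊆ Trivial (discrete A) (discrete A)
  -- Without symbols there is no `app` case. The equations make `a` and `b` the values `σ x` and
  -- `σ y`, so equal variables would give equal values.
  ↑-distinct⊆Trivial a≢b {var x , var y} (σ , refl , refl) =
    distinct-vars-generalize x≢y , distinct-vars-generalize x≢y
    where
    x≢y : x ≢ y
    x≢y = a≢b ∘ cong σ

  -- Clause (i) applies, so no maximality has to be checked.
  distinct⇒≲ : ∀ {a b c d : A} → a ≢ b → c ≢ d →
               ArrowLesssim (discrete A) (discrete A) (a , b) (c , d)
  distinct⇒≲ a≢b c≢d =
    inj₁ λ {g} → [ ↑-distinct⊆Trivial a≢b {g} , ↑-distinct⊆Trivial c≢d {g} ]

  distinct⇒Proportion : ∀ {a b c d : A} → a ≢ b → c ≢ d →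
                        Proportion (discrete A) (discrete A) a b c d
  distinct⇒Proportion a≢b c≢d =
      (distinct⇒≲ a≢b c≢d , distinct⇒≲ c≢d a≢b)
    , (distinct⇒≲ (a≢b ∘ sym) (c≢d ∘ sym) , distinct⇒≲ (c≢d ∘ sym) (a≢b ∘ sym))

  Proportion-reflects-≡ : ∀ {a c d : A} → Proportion (discrete A) (discrete A) a a c d → c ≡ d
  Proportion-reflects-≡ {a} ((p≲q , _) , _)
    -- A constant assignment puts this pair above `a → a`; above `c → d`, the single value at
    -- variable 0 is both `c` and `d`.
    with ≲⇒↑⊆ p≲q {var 0 , var 0} ((λ _ → a) , refl , refl)
  ... | _ , σ0≡c , σ0≡d = trans (sym σ0≡c) σ0≡d

theorem3 : Σ[ L ∈ Language ] Σ[ 𝔄 ∈ Algebra L ] ∃[ a ] ∃[ b ] ∃[ c ] ∃[ d ] ∃[ e ] ∃[ f ]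
    (Proportion 𝔄 𝔄 a b c d × Proportion 𝔄 𝔄 b e d f × ¬ Proportion 𝔄 𝔄 a e c f)
-- Three elements, as `c`, `d`, `f` must be pairwise distinct, whereas `e` returns to `a`.
theorem3 = ∅ , discrete (Fin 3) , 0F , 1F , 0F , 1F , 0F , 2F
  , distinct⇒Proportion (λ ()) (λ ())
  , distinct⇒Proportion (λ ()) (λ ())
  , λ prop → 0F≢2F (Proportion-reflects-≡ prop)
  where
  0F≢2F : _≢_ {A = Fin 3} 0F 2F
  0F≢2F ()
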